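{- For any unimodal range map $\delta$, the partial composition maps $\circ_i$ on $\mathbf{Cl}_\delta$ satisfy, for any $u,v\in\mathsf{Cl}_\delta$ and $1\le i\le|u|$, $$\mathsf{H}_u\circ_i\mathsf{H}_v=\mathsf{H}_{\mathrm{r}_\delta(u\,\blacksquare_i\,v)} .$$
   Context: $\mathbb{N}=\{0,1,2,\dots\}$ and $\mathbb{K}$ is a field of characteristic zero. A range map is a map $\delta:\mathbb{N}\setminus\{0\}\to\mathbb{N}$. It is unimodal if there are no $1\le i_1<i_2<i_3$ with $\delta(i_1)>\delta(i_2)<\delta(i_3)$. For a word $w$ on $\mathbb{N}$, $\ell(w)$ is its length, $w(i)$ its $i$-th letter, $\epsilon$ is the empty word. A $\delta$-cliff is a word $w$ on $\mathbb{N}$ with $0\le w(i)\le\delta(i)$ for all $i$; its size is $|w|:=\ell(w)+1$; $\mathsf{Cl}_\delta$ is the graded set of all $\delta$-cliffs. The $\delta$-reduction of a word $w$ on $\mathbb{N}$ is the $\delta$-cliff $\mathrm{r}_\delta(w)$ of length $\ell(w)$ with $i$-th letter $\min\{w(i),\delta(i)\}$. For words $u,v$ and $1\le i\le|u|$, $u\,\square_i\,v:=u(1)\cdots u(i-1)\;v\;u(i)\cdots u(\ell(u))$. For $\delta$ unimodal, $\mathbf{Cl}_\delta$ is the nonsymmetric operad over $\mathbb{K}$ with basis $\{\mathsf{E}_w:w\in\mathsf{Cl}_\delta\}$ ($\mathsf{E}_w$ of arity $|w|$), partial compositions $\mathsf{E}_u\circ_i\mathsf{E}_v=\mathsf{E}_{u\,\square_i\,v}$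 if $u\,\square_i\,v\in\mathsf{Cl}_\delta$ and $\mathsf{E}_u\circ_i\mathsf{E}_v=0$ otherwise, and unit $\mathsf{E}_\epsilon$. Order: for $u,v$ of the same length, $u\preccurlyeq v$ iff $u(j)\le v(j)$ for all $j$. Fundamental basis: $\mathsf{F}_w:=\sum_{w'\in\mathsf{Cl}_\delta,\,w\preccurlyeq w'}\mu_\preccurlyeq(w,w')\,\mathsf{E}_{w'}$, where $\mu_\preccurlyeq$ is the Möbius function of the poset $\preccurlyeq$ on $\delta$-cliffs of a given size; equivalently $\mathsf{E}_w=\sum_{w'\in\mathsf{Cl}_\delta,\,w\preccurlyeq w'}\mathsf{F}_{w'}$. Homogeneous basis: $\mathsf{H}_w:=\sum_{w'\in\mathsf{Cl}_\delta,\,w'\preccurlyeq w}\mathsf{F}_{w'}$. Operation $\blacksquare_i$: for $w\in\mathsf{Cl}_\delta$ and $f:\{1,\dots,\ell(w)\}\to\mathbb{N}\setminus\{0\}$, let $\mathrm{m}^f_\delta(w)$ be the word of length $\ell(w)$ with $j$-th letter $\delta(f(j))$ if $w(j)=\delta(j)$, and $w(j)$ otherwise. For $u,v\in\mathsf{Cl}_\delta$ and $1\le i\le|u|$, $u\,\blacksquare_i\,v:=\mathrm{m}^f_\delta(u)\,\square_i\,\mathrm{m}^g_\delta(v)$, where $f(j):=j$ if $j\le i-1$, $f(j):=j+\ell(v)$ otherwise, and $g(j):=j+i-1$. (The word $u\,\blacksquare_i\,v$ need not be a $\delta$-cliff.) -}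

module Defs where

open import Algebra.Apartness.Bundles
  using (HeytingField; module HeytingCommutativeRing)
open import Algebra.Bundles using (CommutativeRing)
import Algebra.Definitions.RawMonoid as RawMonoid
open import Data.Bool.Base using (if_then_else_)
open import Data.Fin.Base using (Fin; zero; suc; toℕ; fromℕ<)
import Data.Fin.Properties as Fin
open import Data.Irrelevant using ([_])
open import Data.List.Base using (List; foldr; map; allFin; cartesianProductWith)
import Data.List.Base as List
open import Data.List.Membership.Propositional using (_∈_)
import Data.List.Membership.Propositional.Properties as ∈
open import Data.List.Relation.Unary.All using ([])
open import Data.List.Relation.Unary.AllPairs using ([]; _∷_)
open import Data.List.Relation.Unary.Any using (here)
open import Data.List.Relation.Unary.Unique.Propositional using (Unique)
import Data.List.Relation.Unary.Unique.Propositional.Properties as Unique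
open import Data.Nat.Base using (ℕ; zero; suc; _+_; _⊓_; _≤_; _<_; _>_; s≤s; NonZero)
import Data.Nat.Properties as ℕ
open import Data.Nat.Induction using (<-wellFounded)
open import Data.Product.Base using (_×_; _,_)
open import Data.Refinement.Base using (Refinement-syntax; value; _,_)
open import Data.Vec.Base using (Vec; []; _∷_; _++_; cast; lookup; sum; tabulate)
import Data.Vec.Properties as Vec
open import Data.Vec.Relation.Binary.Pointwise.Inductive as Pointwise
  using (Pointwise; []; _∷_)
open import Function.Base using (_∘_)
open import Induction.WellFounded using (WellFounded; module All; module Subrelation)
open import Level using (Level)
import Relation.Binary.Construct.On as On
open import Relation.Binary.Definitions using (Decidable; DecidableEquality)
open import Relation.Binary.PropositionalEquality.Core
  using (_≡_; _≢_; refl; cong; cong₂; subst; sym)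
open import Relation.Nullary.Decidable.Core
  using (Dec; yes; no; does; map′; ¬?; _×-dec_)
open import Relation.Nullary.Negation.Core using (¬_)

private
  variable
    m n : ℕ

ℕ⁺ : Set
ℕ⁺ = [ i ∈ ℕ ∣ NonZero i ]

infix 8 1+_

1+_ : ℕ → ℕ⁺
1+ i = suc i , [ record {} ]

RangeMap : Set
RangeMap = ℕ⁺ → ℕ

Unimodal : RangeMap → Set
Unimodal δ = ∀ (i₁ i₂ i₃ : ℕ⁺) → value i₁ < value i₂ → value i₂ < value i₃ →
             ¬ (δ i₁ > δ i₂ × δ i₂ < δ i₃)

-- Words are read from position 1: the letter w(j), 1 ≤ j ≤ n, is
-- lookup w j′ where j = 1 + toℕ j′.

Word : ℕ → Set
Word = Vec ℕ

∣_∣ : Word n → ℕ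
∣_∣ {n} _ = suc n

IsCliff : RangeMap → Word n → Set
IsCliff δ w = ∀ j → lookup w j ≤ δ (1+ toℕ j)

isCliff? : ∀ δ (w : Word n) → Dec (IsCliff δ w)
isCliff? δ w = Fin.all? λ j → lookup w j ℕ.≤? δ (1+ toℕ j)

record Cliff (δ : RangeMap) (n : ℕ) : Set where
  constructor cliff
  field
    word     : Word n
    .isCliff : IsCliff δ word

open Cliff public using (word)

word-injective : ∀ {δ} {u v : Cliff δ n} → word u ≡ word v → u ≡ v
word-injective refl = refl

reduce : ∀ δ → Word n → Cliff δ n
reduce δ w =
  cliff (tabulate λ j → lookup w j ⊓ δ (1+ toℕ j)) λ j →
    subst (_≤ δ (1+ toℕ j)) (sym (Vec.lookup∘tabulate _ j))
      (ℕ.m⊓n≤n (lookup w j) _)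

infix 4 _≟_ _≼_ _≼?_ _≺_ _≺?_

_≟_ : ∀ {δ} → DecidableEquality (Cliff δ n)
u ≟ v = map′ word-injective (cong word) (Vec.≡-dec ℕ._≟_ (word u) (word v))

_≼_ : ∀ {δ} → Cliff δ n → Cliff δ n → Set
u ≼ v = Pointwise _≤_ (word u) (word v)

_≼?_ : ∀ {δ} → Decidable (_≼_ {n} {δ})
u ≼? v = Pointwise.decidable ℕ._≤?_ (word u) (word v)

_≺_ : ∀ {δ} → Cliff δ n → Cliff δ n → Set
u ≺ v = u ≼ v × u ≢ v

_≺?_ : ∀ {δ} → Decidable (_≺_ {n} {δ})
u ≺? v = (u ≼? v) ×-dec ¬? (u ≟ v)

private
  sum-mono : {u v : Word n} → Pointwise _≤_ u v → sum u ≤ sum v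
  sum-mono []       = ℕ.≤-refl
  sum-mono (p ∷ ps) = ℕ.+-mono-≤ p (sum-mono ps)

  sum-≡ : {u v : Word n} → Pointwise _≤_ u v → sum u ≡ sum v → u ≡ v
  sum-≡ []       _ = refl
  sum-≡ {u = a ∷ u} {b ∷ v} (p ∷ ps) q = cong₂ _∷_ a≡b u≡v
    where
    a≡b : a ≡ b
    a≡b = ℕ.≤-antisym p (ℕ.+-cancelʳ-≤ (sum v) b a (begin
      b + sum v ≡⟨ q ⟨
      a + sum u ≤⟨ ℕ.+-monoʳ-≤ a (sum-mono ps) ⟩
      a + sum v ∎))
      where open ℕ.≤-Reasoning

    u≡v : u ≡ v
    u≡v with refl ← a≡b = sum-≡ ps (ℕ.+-cancelˡ-≡ a _ _ q)

≺-wellFounded : ∀ {δ} → WellFounded (_≺_ {n} {δ})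
≺-wellFounded = Subrelation.wellFounded
  (λ (u≼v , u≢v) → ℕ.≤∧≢⇒< (sum-mono u≼v) (u≢v ∘ word-injective ∘ sum-≡ u≼v))
  (On.wellFounded (sum ∘ word) <-wellFounded)

shift : RangeMap → RangeMap
shift δ i = δ (1+ value i)

cons : ∀ δ → Fin (suc (δ (1+ 0))) → Cliff (shift δ) n → Cliff δ (suc n)
cons δ a (cliff w p) =
  cliff (toℕ a ∷ w) λ { zero → Fin.toℕ≤pred[n] a ; (suc j) → p j }

cliffs : ∀ δ n → List (Cliff δ n)
cliffs δ zero    = List.[ cliff [] (λ ()) ]
cliffs δ (suc n) =
  cartesianProductWith (cons δ) (allFin (suc (δ (1+ 0)))) (cliffs (shift δ) n)

∈-cliffs : ∀ {δ} (w : Cliff δ n) → w ∈ cliffs δ n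
∈-cliffs (cliff [] _) = here refl
∈-cliffs {δ = δ} (cliff (a ∷ w) p) =
  subst (_∈ cliffs δ _) (word-injective (cong (_∷ w) (Fin.toℕ-fromℕ< _)))
    (∈.∈-cartesianProductWith⁺ (cons δ)
      (∈.∈-allFin (fromℕ< (s≤s (p zero))))
      (∈-cliffs (cliff w λ j → p (suc j))))

cliffs-unique : ∀ δ n → Unique (cliffs δ n)
cliffs-unique δ zero    = [] ∷ []
cliffs-unique δ (suc n) =
  Unique.cartesianProductWith⁺ (cons δ)
    (λ e → Fin.toℕ-injective (Vec.∷-injectiveˡ (cong word e)) ,
           word-injective (Vec.∷-injectiveʳ (cong word e)))
    (Unique.allFin⁺ _) (cliffs-unique (shift δ) n)

-- Here and below, i : Fin ∣ u ∣ stands for the position 1 + toℕ i.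

_□[_]_ : (u : Word m) → Fin ∣ u ∣ → Word n → Word (m + n)
_□[_]_ {m} {n} u zero    v = cast (ℕ.+-comm n m) (v ++ u)
(x ∷ u)        □[ suc i ] v = x ∷ (u □[ i ] v)

modify : ∀ {δ} → (Fin n → ℕ⁺) → Cliff δ n → Word n
modify {δ = δ} f w = tabulate λ j →
  if does (lookup (word w) j ℕ.≟ δ (1+ toℕ j))
  then δ (f j)
  else lookup (word w) j

-- hostPosition i n (resp. guestPosition i) sends the position of a letter of u
-- (resp. v) to its position in u □[ i ] v, where v has length n.

hostPosition : Fin (suc m) → ℕ → Fin m → ℕ⁺
hostPosition i n j =
  if does (toℕ j ℕ.<? toℕ i) then 1+ toℕ j else 1+ (toℕ j + n)

guestPosition : Fin (suc m) → Fin n → ℕ⁺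
guestPosition i j = 1+ (toℕ j + toℕ i)

_■[_]_ : ∀ {δ} (u : Cliff δ m) → Fin ∣ word u ∣ → Cliff δ n → Word (m + n)
_■[_]_ {n = n} u i v =
  modify (hostPosition i n) u □[ i ] modify (guestPosition i) v

CharacteristicZero : ∀ {c ℓ₁ ℓ₂} → HeytingField c ℓ₁ ℓ₂ → Set ℓ₁
CharacteristicZero K = ∀ n → ¬ (suc n · 1#) ≈ 0#
  where
  open HeytingField K using (_≈_; 0#; 1#; heytingCommutativeRing)
  open HeytingCommutativeRing heytingCommutativeRing using (commutativeRing)
  open RawMonoid (CommutativeRing.+-rawMonoid commutativeRing)
    using () renaming (_×_ to _·_)

module Operad {c ℓ₁ ℓ₂} (K : HeytingField c ℓ₁ ℓ₂) (δ : RangeMap) where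

  open HeytingField K
    using (Carrier; _≈_; _*_; -_; 0#; 1#) renaming (_+_ to _+ᴷ_)

  private
    variable
      a : Level
      A : Set a

  ∑ : List A → (A → Carrier) → Carrier
  ∑ xs f = foldr _+ᴷ_ 0# (map f xs)

  when : Dec A → (A → Carrier) → Carrier
  when (yes p) f = f p
  when (no _)  f = 0#

  -- Cl n is the component of arity 1 + n; its elements are given by their
  -- coordinates in the basis E.

  Cl : ℕ → Set c
  Cl n = Cliff δ n → Carrier

  infix 4 _≋_

  _≋_ : Cl n → Cl n → Set ℓ₁
  x ≋ y = ∀ w → x w ≈ y w

  E : Cliff δ n → Cl n
  E w w′ = when (w ≟ w′) λ _ → 1#

  E-comp : (u : Cliff δ m) → Fin ∣ word u ∣ → Cliff δ n → Cl (m + n)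
  E-comp u i v w =
    when (isCliff? δ uv) λ p → E (cliff uv p) w
    where uv = word u □[ i ] word v

  -- The bilinear extension of E-comp.

  _∘⟨_⟩_ : Cl m → Fin (suc m) → Cl n → Cl (m + n)
  _∘⟨_⟩_ {m} {n} x i y w =
    ∑ (cliffs δ m) λ u → ∑ (cliffs δ n) λ v → (x u * y v) * E-comp u i v w

  -- The Möbius function, with values in K: μ x x = 1,
  -- μ x z = - Σ μ x y over x ≼ y ≺ z if x ≺ z, and μ x z = 0 otherwise
  -- (the sum is then empty).

  μ-step : (x z : Cliff δ n) → (∀ {y} → y ≺ z → Carrier) → Carrier
  μ-step {n} x z rec = if does (x ≟ z) then 1# else
    (- ∑ (cliffs δ n) λ y →
       when ((x ≼? y) ×-dec (y ≺? z)) λ (_ , y≺z) → rec y≺z)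

  μ : Cliff δ n → Cliff δ n → Carrier
  μ x = All.wfRec ≺-wellFounded c (λ _ → Carrier) (μ-step x)

  F : Cliff δ n → Cl n
  F {n} w x = ∑ (cliffs δ n) λ w′ → when (w ≼? w′) λ _ → μ w w′ * E w′ x

  H : Cliff δ n → Cl n
  H {n} w x = ∑ (cliffs δ n) λ w′ → when (w′ ≼? w) λ _ → F w′ x

{-# OPTIONS --safe #-}
-- Every basis change here factors over the letters.  In the basis E, the
-- coefficient of H_w at x is the product over j of φ(w(j), x(j)), where
-- φ(a, b) = [b = 0] − [b = a + 1]: the order on cliffs is a product of chains,
-- whose Möbius function is [b = a] − [b = a + 1], and sums over all cliffs of
-- products of functions of the letters are products of sums over one letter.
-- A word of length m + n is u′ □[ i ] v′ for unique words u′ and v′, so the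
-- coefficients of both sides of the proposition are products over the letters
-- of u and v.  They agree factor by factor: for a ≤ d and b ≤ d′,
-- φ(a, b) [b ≤ d] = φ(min(a′, d′), b), where a′ is d′ if a = d, and a otherwise.

module Submission where

open import Defs
open import Algebra.Apartness.Bundles
  using (HeytingField; module HeytingCommutativeRing)
open import Algebra.Bundles using (CommutativeRing; CommutativeMonoid)
import Algebra.Properties.CommutativeMonoid.Sum as CommutativeMonoidSum
import Algebra.Properties.CommutativeSemigroup as CommutativeSemigroup
import Algebra.Properties.Ring as RingProperties
import Algebra.Properties.Semiring.Sum as SemiringSum
open import Data.Bool.Base using (Bool; true; false; if_then_else_; _∧_)
open import Data.Bool.Properties using (if-float)
open import Data.Fin.Base using (Fin; zero; suc; toℕ; cast; _↑ˡ_; _↑ʳ_)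
import Data.Fin.Properties as Fin
open import Data.List.Base
  using (List; []; _∷_; _++_; foldr; map; tabulate; allFin; cartesianProductWith)
import Data.List.Properties as List
open import Data.Nat.Base
  using (ℕ; zero; suc; _+_; _⊓_; _≤_; _<_; z≤n; s≤s; _≡ᵇ_; _<ᵇ_)
import Data.Nat.Properties as ℕ
open import Data.Product.Base using (_,_)
open import Data.Refinement.Base using (value)
open import Data.Vec.Base using ([]; _∷_; lookup) renaming (_++_ to _++ᵛ_)
import Data.Vec.Properties as Vec
import Data.Vec.Relation.Binary.Pointwise.Inductive as Pointwise
open import Function.Base using (_∘_)
open import Induction.WellFounded using (module All; module FixPoint)
open import Relation.Binary.PropositionalEquality as ≡ using (_≡_; cong)
open import Relation.Nullary.Decidable.Core
  using (Dec; yes; no; does; ¬?; _×-dec_; recompute)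
open import Relation.Nullary.Decidable using (dec-false)
open import Relation.Nullary.Negation.Core using (¬_; contradiction)

private
  variable
    m n : ℕ

-- Boolean comparisons of natural numbers.

≡ᵇ-sym : ∀ a b → (a ≡ᵇ b) ≡ (b ≡ᵇ a)
≡ᵇ-sym zero    zero    = ≡.refl
≡ᵇ-sym zero    (suc b) = ≡.refl
≡ᵇ-sym (suc a) zero    = ≡.refl
≡ᵇ-sym (suc a) (suc b) = ≡ᵇ-sym a b

≤?-<ᵇ : ∀ a b → does (a ℕ.≤? b) ≡ (a <ᵇ suc b)
≤?-<ᵇ zero    b = ≡.refl
≤?-<ᵇ (suc a) b = ≡.refl

≤⇒<ᵇ-suc : ∀ {a b} → a ≤ b → (a <ᵇ suc b) ≡ true
≤⇒<ᵇ-suc z≤n       = ≡.refl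
≤⇒<ᵇ-suc (s≤s a≤b) = ≤⇒<ᵇ-suc a≤b

<⇒≢ᵇ : ∀ {a b} → a < b → (a ≡ᵇ b) ≡ false
<⇒≢ᵇ {zero}  (s≤s a<b) = ≡.refl
<⇒≢ᵇ {suc a} (s≤s a<b) = <⇒≢ᵇ a<b

≡ᵇ-⊓ : ∀ a {b k} → b < k → (b ≡ᵇ a) ≡ (b ≡ᵇ a ⊓ k)
≡ᵇ-⊓ zero            b<k       = ≡.refl
≡ᵇ-⊓ (suc a) {zero}  (s≤s b<k) = ≡.refl
≡ᵇ-⊓ (suc a) {suc b} (s≤s b<k) = ≡ᵇ-⊓ a b<k

-- The field `isCliff` is irrelevant; decidability of `IsCliff` recovers a relevant proof.
bounded : ∀ {δ} (w : Cliff δ n) → IsCliff δ (word w)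
bounded {δ = δ} (cliff w p) = recompute (isCliff? δ w) p

-- Where the letters of `u` and `v` land in an insertion.

hostIndex : Fin (suc m) → Fin m → Fin (m + n)
hostIndex {m} {n} zero j = cast (ℕ.+-comm n m) (n ↑ʳ j)
hostIndex (suc i) zero    = zero
hostIndex (suc i) (suc j) = suc (hostIndex i j)

guestIndex : Fin (suc m) → Fin n → Fin (m + n)
guestIndex {m} {n} zero j = cast (ℕ.+-comm n m) (j ↑ˡ m)
guestIndex {suc m} (suc i) j = suc (guestIndex i j)

lookup-host : ∀ (u : Word m) i (v : Word n) j →
              lookup (u □[ i ] v) (hostIndex i j) ≡ lookup u j
lookup-host {m} {n} u zero v j =
  ≡.trans (Vec.lookup-cast (ℕ.+-comm n m) (v ++ᵛ u) _) (Vec.lookup-++ʳ v u j)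
lookup-host (a ∷ u) (suc i) v zero    = ≡.refl
lookup-host (a ∷ u) (suc i) v (suc j) = lookup-host u i v j

lookup-guest : ∀ (u : Word m) i (v : Word n) j →
               lookup (u □[ i ] v) (guestIndex i j) ≡ lookup v j
lookup-guest {m} {n} u zero v j =
  ≡.trans (Vec.lookup-cast (ℕ.+-comm n m) (v ++ᵛ u) _) (Vec.lookup-++ˡ v u j)
lookup-guest (a ∷ u) (suc i) v j = lookup-guest u i v j

-- `hostIndex` follows the recursion of `□`, which suits lookups, whereas `■` tests whether `j`
-- precedes `i`; this reconciles the two.
hostIndex-position : ∀ (i : Fin (suc m)) n (j : Fin m) →
                     1+ toℕ (hostIndex {n = n} i j) ≡ hostPosition i n j
hostIndex-position {m} zero n j = cong 1+_ (begin
  toℕ (cast (ℕ.+-comm n m) (n ↑ʳ j)) ≡⟨ Fin.toℕ-cast _ (n ↑ʳ j) ⟩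
  toℕ (n ↑ʳ j)                       ≡⟨ Fin.toℕ-↑ʳ n j ⟩
  n + toℕ j                          ≡⟨ ℕ.+-comm n (toℕ j) ⟩
  toℕ j + n                          ∎)
  where open ≡.≡-Reasoning
hostIndex-position (suc i) n zero    = ≡.refl
-- The test at two successors computes to the test at `j` and `i`; it remains to move the successor
-- into both branches.
hostIndex-position (suc i) n (suc j) =
  ≡.trans (cong (λ p → 1+ value p) (hostIndex-position i n j))
          (if-float (λ p → 1+ value p) (does (toℕ j ℕ.<? toℕ i)))

guestIndex-position : ∀ (i : Fin (suc m)) (j : Fin n) →
                      1+ toℕ (guestIndex i j) ≡ guestPosition i j
guestIndex-position i j = cong 1+_ (toℕ-guestIndex i j)
  where
  toℕ-guestIndex : ∀ {m n} (i : Fin (suc m)) (j : Fin n) →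
                   toℕ (guestIndex i j) ≡ toℕ j + toℕ i
  toℕ-guestIndex {m} {n} zero j = begin
    toℕ (cast (ℕ.+-comm n m) (j ↑ˡ m)) ≡⟨ Fin.toℕ-cast _ (j ↑ˡ m) ⟩
    toℕ (j ↑ˡ m)                       ≡⟨ Fin.toℕ-↑ˡ j m ⟩
    toℕ j                              ≡⟨ ℕ.+-identityʳ (toℕ j) ⟨
    toℕ j + 0                          ∎
    where open ≡.≡-Reasoning
  toℕ-guestIndex {suc m} (suc i) j =
    ≡.trans (cong suc (toℕ-guestIndex i j)) (≡.sym (ℕ.+-suc (toℕ j) (toℕ i)))

module _ {c ℓ} (M : CommutativeMonoid c ℓ) where

  open CommutativeMonoid M
  open CommutativeSemigroup commutativeSemigroup using (x∙yz≈y∙xz)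
  open CommutativeMonoidSum M using (sum; sum-cong-≗)

  private
    sum-cast : ∀ {k l} (eq : k ≡ l) (g : Fin l → Carrier) →
               sum g ≡ sum (g ∘ cast eq)
    sum-cast ≡.refl g = sum-cong-≗ λ j → cong g (≡.sym (Fin.cast-is-id ≡.refl j))

    sum-↑ : ∀ n {m} (g : Fin (n + m) → Carrier) →
            sum g ≈ sum (g ∘ (n ↑ʳ_)) ∙ sum (g ∘ (_↑ˡ m))
    sum-↑ zero    g = sym (identityʳ _)
    sum-↑ (suc n) g = trans (∙-congˡ (sum-↑ n (g ∘ suc))) (x∙yz≈y∙xz _ _ _)

  -- Each position comes from exactly one letter of `u` or `v`. In the multiplicative monoid, `sum`
  -- is a product.
  sum-host-guest : ∀ (i : Fin (suc m)) (g : Fin (m + n) → Carrier) →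
                   sum g ≈ sum (g ∘ hostIndex i) ∙ sum (g ∘ guestIndex i)
  sum-host-guest {m} {n} zero g =
    trans (reflexive (sum-cast (ℕ.+-comm n m) g)) (sum-↑ n _)
  sum-host-guest {suc m} (suc i) g =
    trans (∙-congˡ (sum-host-guest i (g ∘ suc))) (sym (assoc _ _ _))

-- Finite sums and products over letters.

module Letters {c ℓ} (R : CommutativeRing c ℓ) where

  open CommutativeRing R hiding (zero) renaming (_+_ to _+ᴿ_; _-_ to _-ᴿ_)
  open RingProperties ring
    using (-‿distribˡ-*; -‿distribʳ-*; -0#≈0#)
  open SemiringSum semiring public
    using (sum; sum-cong-≋; *-distribʳ-sum; ∑-distrib-+; sum-replicate-zero)
  open CommutativeMonoidSum *-commutativeMonoid public
    using () renaming (sum to ∏; sum-cong-≋ to ∏-cong; ∑-distrib-+ to ∏-distrib-*)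
  open CommutativeSemigroup +-commutativeSemigroup using (interchange)
  open import Relation.Binary.Reasoning.Setoid setoid

  ι : Bool → Carrier
  ι b = if b then 1# else 0#

  ι-cong : ∀ {b b′} → b ≡ b′ → ι b ≈ ι b′
  ι-cong = reflexive ∘ cong ι

  ι-∧ : ∀ b b′ → ι (b ∧ b′) ≈ ι b * ι b′
  ι-∧ true  b′ = sym (*-identityˡ _)
  ι-∧ false b′ = sym (zeroˡ _)

  x-0#≈x : ∀ {x y} → y ≈ 0# → x -ᴿ y ≈ x
  x-0#≈x {x} y≈0 = trans (+-congˡ (trans (-‿cong y≈0) -0#≈0#)) (+-identityʳ x)

  ∑ : ∀ {a} {A : Set a} → List A → (A → Carrier) → Carrier
  ∑ xs f = foldr _+ᴿ_ 0# (map f xs)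

  module _ {a} {A : Set a} where

    ∑-cong : ∀ (xs : List A) {f g} → (∀ x → f x ≈ g x) → ∑ xs f ≈ ∑ xs g
    ∑-cong []       f≈g = refl
    ∑-cong (x ∷ xs) f≈g = +-cong (f≈g x) (∑-cong xs f≈g)

    ∑-+ : ∀ (xs : List A) f g → ∑ xs (λ x → f x +ᴿ g x) ≈ ∑ xs f +ᴿ ∑ xs g
    ∑-+ []       f g = sym (+-identityˡ 0#)
    ∑-+ (x ∷ xs) f g = trans (+-congˡ (∑-+ xs f g)) (interchange _ _ _ _)

    ∑-*ˡ : ∀ (xs : List A) r f → ∑ xs (λ x → r * f x) ≈ r * ∑ xs f
    ∑-*ˡ []       r f = sym (zeroʳ r)
    ∑-*ˡ (x ∷ xs) r f = trans (+-congˡ (∑-*ˡ xs r f)) (sym (distribˡ _ _ _))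

    ∑-*ʳ : ∀ (xs : List A) f r → ∑ xs (λ x → f x * r) ≈ ∑ xs f * r
    ∑-*ʳ []       f r = sym (zeroˡ r)
    ∑-*ʳ (x ∷ xs) f r = trans (+-congˡ (∑-*ʳ xs f r)) (sym (distribʳ _ _ _))

    ∑-++ : ∀ (xs ys : List A) f → ∑ (xs ++ ys) f ≈ ∑ xs f +ᴿ ∑ ys f
    ∑-++ []       ys f = sym (+-identityˡ _)
    ∑-++ (x ∷ xs) ys f = trans (+-congˡ (∑-++ xs ys f)) (sym (+-assoc _ _ _))

  ∑-cartesianProductWith :
    ∀ {a} {A B C : Set a} (h : A → B → C) xs ys f →
    ∑ (cartesianProductWith h xs ys) f ≈ ∑ xs λ x → ∑ ys λ y → f (h x y)
  ∑-cartesianProductWith h []       ys f = refl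
  ∑-cartesianProductWith h (x ∷ xs) ys f = begin
    ∑ (map (h x) ys ++ cartesianProductWith h xs ys) f
      ≈⟨ ∑-++ (map (h x) ys) _ f ⟩
    ∑ (map (h x) ys) f +ᴿ ∑ (cartesianProductWith h xs ys) f
      ≈⟨ +-cong (reflexive (cong (foldr _+ᴿ_ 0#) (≡.sym (List.map-∘ ys))))
                (∑-cartesianProductWith h xs ys f) ⟩
    ∑ ys (f ∘ h x) +ᴿ ∑ xs (λ x → ∑ ys λ y → f (h x y)) ∎

  ∑-allFin : ∀ k (f : Fin k → Carrier) → ∑ (allFin k) f ≡ sum f
  ∑-allFin k f =
    ≡.trans (cong (foldr _+ᴿ_ 0#) (List.map-tabulate (λ j → j) f)) (foldr-tabulate k f)
    where
    foldr-tabulate : ∀ k (f : Fin k → Carrier) →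
                     foldr _+ᴿ_ 0# (tabulate f) ≡ sum f
    foldr-tabulate zero    f = ≡.refl
    foldr-tabulate (suc k) f = cong (f zero +ᴿ_) (foldr-tabulate k (f ∘ suc))

  -- Distributivity: the letters of a cliff vary independently, and removing the first one leaves a
  -- cliff for `shift δ`.
  ∑-cliffs-∏ : ∀ δ n (f : Fin n → ℕ → Carrier) →
    ∑ (cliffs δ n) (λ w → ∏ λ j → f j (lookup (word w) j)) ≈
    ∏ λ j → sum {suc (δ (1+ toℕ j))} λ b → f j (toℕ b)
  ∑-cliffs-∏ δ zero    f = +-identityʳ 1#
  ∑-cliffs-∏ δ (suc n) f = begin
    ∑ (cliffs δ (suc n)) (λ w → ∏ λ j → f j (lookup (word w) j))
      ≈⟨ ∑-cartesianProductWith (cons δ) (allFin k) (cliffs (shift δ) n) _ ⟩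
    ∑ (allFin k) (λ b → ∑ (cliffs (shift δ) n) λ w →
      f zero (toℕ b) * ∏ λ j → f (suc j) (lookup (word w) j))
      ≈⟨ ∑-cong (allFin k) (λ b → trans (∑-*ˡ (cliffs (shift δ) n) _ _)
           (*-congˡ (∑-cliffs-∏ (shift δ) n (f ∘ suc)))) ⟩
    ∑ (allFin k) (λ b → f zero (toℕ b) * _)
      ≈⟨ ∑-*ʳ (allFin k) _ _ ⟩
    ∑ (allFin k) (λ b → f zero (toℕ b)) * _
      ≈⟨ *-congʳ (reflexive (∑-allFin k _)) ⟩
    sum {k} (λ b → f zero (toℕ b)) * _ ∎
    where k = suc (δ (1+ 0))

  -- The form used throughout: pairing two product kernels reduces to a convolution at each letter.
  ∑-cliffs-∏-* : ∀ δ n (f g : Fin n → ℕ → Carrier) {h : Fin n → Carrier} →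
    (∀ j → sum {suc (δ (1+ toℕ j))} (λ b → f j (toℕ b) * g j (toℕ b)) ≈ h j) →
    ∑ (cliffs δ n) (λ w → (∏ λ j → f j (lookup (word w) j)) *
                          (∏ λ j → g j (lookup (word w) j))) ≈ ∏ h
  ∑-cliffs-∏-* δ n f g eq = trans
    (∑-cong (cliffs δ n) λ w →
      sym (∏-distrib-* (λ j → f j (lookup (word w) j)) (λ j → g j (lookup (word w) j))))
    (trans (∑-cliffs-∏ δ n λ j b → f j b * g j b) (∏-cong eq))

  -- The bracket on the right is there because `c` may lie outside the range of summation.
  sum-[≡] : ∀ k c (g : ℕ → Carrier) →
            sum {k} (λ b → ι (toℕ b ≡ᵇ c) * g (toℕ b)) ≈ ι (c <ᵇ k) * g c
  sum-[≡] zero    c       g = sym (zeroˡ _)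
  sum-[≡] (suc k) zero    g =
    trans (+-congˡ (trans (sum-cong-≋ {k} λ b → zeroˡ _) (sum-replicate-zero k)))
          (+-identityʳ _)
  sum-[≡] (suc k) (suc c) g =
    trans (+-cong (zeroˡ _) (sum-[≡] k c (g ∘ suc))) (+-identityˡ _)

  sum-[≡]-≤ : ∀ {k c} (g : ℕ → Carrier) → c ≤ k →
              sum {suc k} (λ b → ι (toℕ b ≡ᵇ c) * g (toℕ b)) ≈ g c
  sum-[≡]-≤ {k} {c} g c≤k =
    trans (sum-[≡] (suc k) c g)
          (trans (*-congʳ (ι-cong (≤⇒<ᵇ-suc c≤k))) (*-identityˡ _))

  sum-[≡]-[≡] : ∀ k c d (g : ℕ → Carrier) →
    sum {k} (λ b → (ι (toℕ b ≡ᵇ c) -ᴿ ι (toℕ b ≡ᵇ d)) * g (toℕ b)) ≈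
    ι (c <ᵇ k) * g c -ᴿ ι (d <ᵇ k) * g d
  sum-[≡]-[≡] k c d g = begin
    sum {k} (λ b → (ι (toℕ b ≡ᵇ c) -ᴿ ι (toℕ b ≡ᵇ d)) * g (toℕ b))
      -- The sign passes to `g`, so that `sum-[≡]` applies to both halves.
      ≈⟨ sum-cong-≋ {k} (λ b → trans (distribʳ _ _ _) (+-congˡ
           (trans (sym (-‿distribˡ-* _ _)) (-‿distribʳ-* _ _)))) ⟩
    sum {k} (λ b → ι (toℕ b ≡ᵇ c) * g (toℕ b) +ᴿ ι (toℕ b ≡ᵇ d) * - g (toℕ b))
      ≈⟨ ∑-distrib-+ {k} _ _ ⟩
    sum {k} (λ b → ι (toℕ b ≡ᵇ c) * g (toℕ b)) +ᴿ
    sum {k} (λ b → ι (toℕ b ≡ᵇ d) * - g (toℕ b))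
      ≈⟨ +-cong (sum-[≡] k c g) (sum-[≡] k d (-_ ∘ g)) ⟩
    ι (c <ᵇ k) * g c +ᴿ ι (d <ᵇ k) * - g d
      ≈⟨ +-congˡ (sym (-‿distribʳ-* _ _)) ⟩
    ι (c <ᵇ k) * g c -ᴿ ι (d <ᵇ k) * g d ∎

  -- Incidence functions of a chain.

  ζ : ℕ → ℕ → Carrier
  ζ a b = ι (a <ᵇ suc b)

  -- The Möbius function of the chain of natural numbers. Thanks to the Boolean comparisons, `ζ` and
  -- `μ₁` at two successors compute to their values at the predecessors.
  μ₁ : ℕ → ℕ → Carrier
  μ₁ a b = ι (b ≡ᵇ a) -ᴿ ι (b ≡ᵇ suc a)

  φ : ℕ → ℕ → Carrier
  φ a b = ι (b ≡ᵇ 0) -ᴿ ι (b ≡ᵇ suc a)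

  μ₁-diag : ∀ a → μ₁ a a ≈ 1#
  μ₁-diag zero    = x-0#≈x refl
  μ₁-diag (suc a) = μ₁-diag a

  -- The support of `μ₁ a` is `a` and `suc a`. Through `ζ*M`, this absorbs the guards `w ≼ w′` in
  -- sums.
  ζ*μ₁ : ∀ a b → ζ a b * μ₁ a b ≈ μ₁ a b
  ζ*μ₁ zero    b       = *-identityˡ _
  ζ*μ₁ (suc a) zero    = trans (zeroˡ _) (sym (x-0#≈x refl))
  ζ*μ₁ (suc a) (suc b) = ζ*μ₁ a b

  -- Möbius inversion on a chain: the terms at `a` and `suc a` cancel if `a < c`, the first alone
  -- survives if `a = c`, and both vanish if `a > c`.
  sum-μ₁*ζ : ∀ {k} a c → c ≤ k →
             sum {suc k} (λ b → μ₁ a (toℕ b) * ζ (toℕ b) c) ≈ ι (a ≡ᵇ c)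
  sum-μ₁*ζ {k} a c c≤k =
    trans (sum-[≡]-[≡] (suc k) a (suc a) (λ b → ζ b c)) (difference a c c≤k)
    where
    difference : ∀ {k} a c → c ≤ k →
      ι (a <ᵇ suc k) * ζ a c -ᴿ ι (suc a <ᵇ suc k) * ζ (suc a) c ≈ ι (a ≡ᵇ c)
    difference zero    zero    z≤n       = trans (x-0#≈x (zeroʳ _)) (*-identityˡ 1#)
    difference (suc a) zero    z≤n       = trans (x-0#≈x (zeroʳ _)) (zeroʳ _)
    -- By `c ≤ k`, the bound `k` is a successor, so the subtracted term is within range and cancels
    -- the first.
    difference zero    (suc c) (s≤s c≤k) = -‿inverseʳ _
    difference (suc a) (suc c) (s≤s c≤k) = difference a c c≤k

  -- For `c > 0` only `b = c` and `b = c - 1` contribute, and [c ≤ a] - [c - 1 ≤ a] is nonzero only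
  -- at `c = a + 1`. At `c = 0` there is no predecessor, and the sum is 1.
  sum-ζ*μ₁ : ∀ {k} a c → c ≤ k →
             sum {suc k} (λ b → ζ (toℕ b) a * μ₁ (toℕ b) c) ≈ φ a c
  sum-ζ*μ₁ {k} a zero z≤n = begin
    sum {suc k} (λ b → ζ (toℕ b) a * μ₁ (toℕ b) 0)
      ≈⟨ sum-cong-≋ {suc k} (λ b → trans (*-comm (ζ (toℕ b) a) _)
           (*-congʳ (trans (x-0#≈x refl) (ι-cong (≡ᵇ-sym 0 (toℕ b)))))) ⟩
    sum {suc k} (λ b → ι (toℕ b ≡ᵇ 0) * ζ (toℕ b) a)
      ≈⟨ sum-[≡]-≤ {k} (λ b → ζ b a) z≤n ⟩
    1#
      ≈⟨ x-0#≈x refl ⟨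
    φ a 0 ∎
  sum-ζ*μ₁ {suc k} a (suc c) (s≤s c≤k) = begin
    sum {suc (suc k)} (λ b → ζ (toℕ b) a * μ₁ (toℕ b) (suc c))
      ≈⟨ sum-cong-≋ {suc (suc k)} (λ b → trans (*-comm (ζ (toℕ b) a) _) (*-congʳ (+-cong
           (ι-cong (≡ᵇ-sym (suc c) (toℕ b))) (-‿cong (ι-cong (≡ᵇ-sym c (toℕ b))))))) ⟩
    sum {suc (suc k)} (λ b → (ι (toℕ b ≡ᵇ suc c) -ᴿ ι (toℕ b ≡ᵇ c)) * ζ (toℕ b) a)
      ≈⟨ sum-[≡]-[≡] (suc (suc k)) (suc c) c (λ b → ζ b a) ⟩
    ι (c <ᵇ suc k) * ζ (suc c) a -ᴿ ι (c <ᵇ suc (suc k)) * ζ c a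
      ≈⟨ +-cong (one (≤⇒<ᵇ-suc c≤k)) (-‿cong (one (≤⇒<ᵇ-suc (ℕ.m≤n⇒m≤1+n c≤k)))) ⟩
    ζ (suc c) a -ᴿ ζ c a
      ≈⟨ difference c a ⟩
    φ a (suc c) ∎
    where
    one : ∀ {b x} → b ≡ true → ι b * x ≈ x
    one ≡.refl = *-identityˡ _

    difference : ∀ c a → ζ (suc c) a -ᴿ ζ c a ≈ 0# -ᴿ ι (c ≡ᵇ a)
    difference zero    zero    = refl
    difference zero    (suc a) = trans (-‿inverseʳ 1#) (sym (x-0#≈x refl))
    difference (suc c) zero    = refl
    difference (suc c) (suc a) = difference c a

  -- At `b = 0` both sides are 1. If `a = d`, the bracket kills the negative term at `d + 1`, and on
  -- the right that term sits at `d′ + 1`, out of reach of `b`. If `a < d`, the negative term at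
  -- `a + 1` passes the bracket, and for `b ≤ d′` the cap does not affect it. A variable decision
  -- `a≟d` lets the `if` reduce by matching.
  truncate-φ : ∀ {a d b d′} (a≟d : Dec (a ≡ d)) → a ≤ d → b ≤ d′ →
    ι (b <ᵇ suc d) * φ a b ≈ φ ((if does a≟d then d′ else a) ⊓ d′) b
  truncate-φ {b = zero} a≟d a≤d b≤d′ = *-identityˡ _
  truncate-φ {a} {b = suc b} {d′} (yes ≡.refl) a≤d b<d′ =
    trans (annihilate a b) (sym (x-0#≈x (ι-cong
      (≡.trans (cong (b ≡ᵇ_) (ℕ.⊓-idem d′)) (<⇒≢ᵇ b<d′)))))
    where
    annihilate : ∀ d b → ι (b <ᵇ d) * (0# -ᴿ ι (b ≡ᵇ d)) ≈ 0#
    annihilate zero    b       = zeroˡ _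
    annihilate (suc d) zero    = trans (*-identityˡ _) (x-0#≈x refl)
    annihilate (suc d) (suc b) = annihilate d b
  truncate-φ {a} {b = suc b} {d′} (no a≢d) a≤d b<d′ =
    trans (absorb b (ℕ.≤∧≢⇒< a≤d a≢d)) (+-congˡ (-‿cong (ι-cong (≡ᵇ-⊓ a b<d′))))
    where
    absorb : ∀ {a d} b → a < d → ι (b <ᵇ d) * (0# -ᴿ ι (b ≡ᵇ a)) ≈ 0# -ᴿ ι (b ≡ᵇ a)
    absorb         zero    (s≤s _)   = *-identityˡ _
    absorb {zero}  (suc b) (s≤s _)   =
      trans (*-congˡ (x-0#≈x refl)) (trans (zeroʳ _) (sym (x-0#≈x refl)))
    absorb {suc a} (suc b) (s≤s a<d) = absorb {a} b a<d

  sum-φ-[≡] : ∀ {a d b d′} → a ≤ d → b ≤ d′ →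
    sum {suc d} (λ x → φ a (toℕ x) * ι (toℕ x ≡ᵇ b)) ≈
    φ ((if does (a ℕ.≟ d) then d′ else a) ⊓ d′) b
  sum-φ-[≡] {a} {d} {b} {d′} a≤d b≤d′ = begin
    sum {suc d} (λ x → φ a (toℕ x) * ι (toℕ x ≡ᵇ b))
      ≈⟨ sum-cong-≋ {suc d} (λ x → *-comm (φ a (toℕ x)) (ι (toℕ x ≡ᵇ b))) ⟩
    sum {suc d} (λ x → ι (toℕ x ≡ᵇ b) * φ a (toℕ x))
      -- The bracket stays: `b` obeys the bound `d′` of its position in the composite and may exceed
      -- `d`.
      ≈⟨ sum-[≡] (suc d) b (φ a) ⟩
    ι (b <ᵇ suc d) * φ a b
      ≈⟨ truncate-φ (a ℕ.≟ d) a≤d b≤d′ ⟩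
    φ ((if does (a ℕ.≟ d) then d′ else a) ⊓ d′) b ∎

  -- The decision on vectors computes to a conjunction over letters, which `ι` turns into a product.
  ι-≼ : ∀ (u v : Word n) → ι (does (Pointwise.decidable ℕ._≤?_ u v)) ≈
                           ∏ λ j → ζ (lookup u j) (lookup v j)
  ι-≼ []      []      = refl
  ι-≼ (a ∷ u) (b ∷ v) =
    trans (ι-∧ (does (a ℕ.≤? b)) _) (*-cong (ι-cong (≤?-<ᵇ a b)) (ι-≼ u v))

  ι-≟ : ∀ (u v : Word n) → ι (does (Vec.≡-dec ℕ._≟_ u v)) ≈
                           ∏ λ j → ι (lookup u j ≡ᵇ lookup v j)
  ι-≟ []      []      = refl
  ι-≟ (a ∷ u) (b ∷ v) = trans (ι-∧ (a ≡ᵇ b) _) (*-congˡ (ι-≟ u v))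

  ∏-1# : ∀ {n} {f : Fin n → Carrier} → (∀ j → f j ≈ 1#) → ∏ f ≈ 1#
  ∏-1# {zero}  f≈1 = refl
  ∏-1# {suc n} f≈1 = trans (*-cong (f≈1 zero) (∏-1# (f≈1 ∘ suc))) (*-identityˡ 1#)

module _ {c ℓ₁ ℓ₂} (K : HeytingField c ℓ₁ ℓ₂) (δ : RangeMap) where

  private
    R : CommutativeRing c ℓ₁
    R = HeytingCommutativeRing.commutativeRing (HeytingField.heytingCommutativeRing K)

  open CommutativeRing R hiding (zero) renaming (_+_ to _+ᴿ_; _-_ to _-ᴿ_)
  open Operad K δ hiding (∑)
  open Letters R
  open CommutativeSemigroup *-commutativeSemigroup using (interchange)
  open RingProperties ring using (+-inverseʳ-unique)
  open import Relation.Binary.Reasoning.Setoid setoid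

  -- Conditional terms as multiples of brackets.

  when-≈ : ∀ {a} {A : Set a} (d : Dec A) {f x} → (∀ p → f p ≈ x) →
           when d f ≈ ι (does d) * x
  when-≈ (yes p) f≈x = trans (f≈x p) (sym (*-identityˡ _))
  when-≈ (no _)  f≈x = sym (zeroˡ _)

  when-≈0# : ∀ {a} {A : Set a} (d : Dec A) {f} → ¬ A → when d f ≈ 0#
  when-≈0# (yes p) ¬p = contradiction p ¬p
  when-≈0# (no _)  ¬p = refl

  when-≼ : ∀ (u v : Cliff δ n) {x} →
           when (u ≼? v) (λ _ → x) ≈
           (∏ λ j → ζ (lookup (word u) j) (lookup (word v) j)) * x
  when-≼ u v = trans (when-≈ (u ≼? v) λ _ → refl) (*-congʳ (ι-≼ (word u) (word v)))

  if-≈ : ∀ {a} {A : Set a} (d : Dec A) {x y z : Carrier} →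
         (A → x ≈ z) → (¬ A → y ≈ z) → (if does d then x else y) ≈ z
  if-≈ (yes p) x≈z y≈z = x≈z p
  if-≈ (no ¬p) x≈z y≈z = y≈z ¬p

  E-∏ : ∀ (w x : Cliff δ n) →
        E w x ≈ ∏ λ j → ι (lookup (word w) j ≡ᵇ lookup (word x) j)
  E-∏ w x = trans (when-≈ (w ≟ x) λ _ → refl)
                  (trans (*-identityʳ _) (ι-≟ (word w) (word x)))

  -- The Möbius function of cliffs as a product.

  M : Cliff δ n → Cliff δ n → Carrier
  M x z = ∏ λ j → μ₁ (lookup (word x) j) (lookup (word z) j)

  ζ*M : ∀ (x z : Cliff δ n) →
        (∏ λ j → ζ (lookup (word x) j) (lookup (word z) j)) * M x z ≈ M x z
  ζ*M x z = trans (sym (∏-distrib-* (λ j → ζ (lookup (word x) j) (lookup (word z) j)) _))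
                  (∏-cong λ j → ζ*μ₁ (lookup (word x) j) (lookup (word z) j))

  -- Well-founded recursion does not unfold by computation at a variable; the fixed-point equation
  -- requires that `μ-step` depend only on the values of its recursive calls.
  μ-unfold : ∀ (x z : Cliff δ n) → μ x z ≡ μ-step x z λ {y} _ → μ x y
  μ-unfold x z = FixPoint.unfold-wfRec ≺-wellFounded (λ _ → Carrier) (μ-step x) step-ext
    where
    when-ext : ∀ {a} {A : Set a} (d : Dec A) {f g : A → Carrier} →
               (∀ p → f p ≡ g p) → when d f ≡ when d g
    when-ext (yes p) f≡g = f≡g p
    when-ext (no _)  f≡g = ≡.refl

    step-ext : ∀ z {f g : ∀ {y} → y ≺ z → Carrier} → (∀ {y} (y≺z : y ≺ z) → f y≺z ≡ g y≺z) →
               μ-step x z f ≡ μ-step x z g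
    step-ext z f≡g = cong (λ s → if does (x ≟ z) then 1# else (- s))
      (cong (foldr _+ᴿ_ 0#) (List.map-cong
        (λ y → when-ext ((x ≼? y) ×-dec (y ≺? z)) λ (_ , y≺z) → f≡g y≺z) (cliffs δ _)))

  -- Splits off the term y = z from a sum over x ≼ y ≼ z, leaving the sum over
  -- x ≼ y ≺ z of the recursion for μ.
  split-≼ : ∀ {P Q S : Set} (p : Dec P) (q : Dec Q) (s : Dec S) {f x} →
            ι (does p) * x ≈ x → (S → Q) → (∀ t → f t ≈ x) →
            x * ι (does q) ≈ when (p ×-dec (q ×-dec ¬? s)) f +ᴿ ι (does s) * x
  split-≼ p       (yes q) (yes s) px≈x S⇒Q f≈x = trans (*-comm _ _) (sym (trans
    (+-congʳ (when-≈0# (p ×-dec (yes q ×-dec ¬? (yes s))) λ (_ , _ , ¬s) → ¬s s))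
    (+-identityˡ _)))
  split-≼ p       (no ¬q) (yes s) px≈x S⇒Q f≈x = contradiction (S⇒Q s) ¬q
  split-≼ (yes p) (yes q) (no ¬s) px≈x S⇒Q f≈x =
    trans (*-identityʳ _) (sym (trans (+-cong (f≈x _) (zeroˡ _)) (+-identityʳ _)))
  split-≼ (no ¬p) (yes q) (no ¬s) px≈x S⇒Q f≈x =
    trans (*-identityʳ _) (trans (sym px≈x) (sym (+-identityˡ _)))
  split-≼ p       (no ¬q) (no ¬s) px≈x S⇒Q f≈x = trans (zeroʳ _) (sym (trans
    (+-cong (when-≈0# (p ×-dec (no ¬q ×-dec ¬? (no ¬s))) λ (_ , q , _) → ¬q q) (zeroˡ _))
    (+-identityˡ _)))

  -- Well-founded induction on `z`: `M` satisfies the recursion defining `μ`, because its sums over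
  -- `y ≼ z` factor into the chain sums of `sum-μ₁*ζ`.
  μ-∏ : ∀ (x z : Cliff δ n) → μ x z ≈ M x z
  μ-∏ {n} x = All.wfRec ≺-wellFounded ℓ₁ (λ z → μ x z ≈ M x z) λ z rec →
    trans (reflexive (μ-unfold x z)) (step z rec)
    where
    step : ∀ z → (∀ {y} → y ≺ z → μ x y ≈ M x y) → μ-step x z (λ {y} _ → μ x y) ≈ M x z
    step z rec = if-≈ (x ≟ z)
      (λ { ≡.refl → sym (∏-1# λ j → μ₁-diag (lookup (word x) j)) })
      -- The recursion gives `- s`, so it suffices that `s` and `M x z` add up to zero.
      λ x≢z → sym (+-inverseʳ-unique s (M x z) (begin
      s +ᴿ M x z
        -- `M x z` is expanded as the sum of [y = z] `M x y`, to be merged with `s` term by term.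
        ≈⟨ +-congˡ (∑-cliffs-∏-* δ n
             (λ j b → ι (b ≡ᵇ lookup (word z) j)) (λ j → μ₁ (lookup (word x) j))
             (λ j → sum-[≡]-≤ (μ₁ (lookup (word x) j)) (bounded z j))) ⟨
      s +ᴿ ∑ (cliffs δ n) (λ y → (∏ λ j → ι (lookup (word y) j ≡ᵇ lookup (word z) j)) * M x y)
        ≈⟨ ∑-+ (cliffs δ n) _ _ ⟨
      ∑ (cliffs δ n) (λ y → t y +ᴿ
        (∏ λ j → ι (lookup (word y) j ≡ᵇ lookup (word z) j)) * M x y)
        ≈⟨ ∑-cong (cliffs δ n) (λ y → trans (split y) (+-congˡ (*-congʳ (ι-≟ (word y) (word z))))) ⟨
      ∑ (cliffs δ n) (λ y → M x y * ι (does (y ≼? z)))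
        ≈⟨ ∑-cong (cliffs δ n) (λ y → *-congˡ (ι-≼ (word y) (word z))) ⟩
      ∑ (cliffs δ n) (λ y → M x y * (∏ λ j → ζ (lookup (word y) j) (lookup (word z) j)))
        ≈⟨ ∑-cliffs-∏-* δ n
             (λ j → μ₁ (lookup (word x) j)) (λ j b → ζ b (lookup (word z) j))
             (λ j → sum-μ₁*ζ (lookup (word x) j) _ (bounded z j)) ⟩
      (∏ λ j → ι (lookup (word x) j ≡ᵇ lookup (word z) j))
        ≈⟨ ι-≟ (word x) (word z) ⟨
      ι (does (x ≟ z))
        ≡⟨ cong ι (dec-false (x ≟ z) x≢z) ⟩
      0# ∎))
      where
      t : Cliff δ n → Carrier
      t y = when ((x ≼? y) ×-dec (y ≺? z)) λ _ → μ x y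

      s : Carrier
      s = ∑ (cliffs δ n) t

      split : ∀ y → M x y * ι (does (y ≼? z)) ≈ t y +ᴿ ι (does (y ≟ z)) * M x y
      split y = split-≼ (x ≼? y) (y ≼? z) (y ≟ z)
        (trans (*-congʳ (ι-≼ (word x) (word y))) (ζ*M x y))
        (λ { ≡.refl → Pointwise.refl ℕ.≤-refl }) (λ (_ , y≺z) → rec y≺z)

  -- Coordinates of the fundamental and homogeneous bases.

  F-∏ : ∀ (w x : Cliff δ n) → F w x ≈ M w x
  F-∏ {n} w x = begin
    F w x
      -- `M w y` absorbs the guard `w ≼ y`, and the coordinate of `E y` at `x` becomes a bracket
      -- selecting `y = x`.
      ≈⟨ ∑-cong (cliffs δ n) (λ y → trans (when-≼ w y) (trans (*-congˡ (*-cong (μ-∏ w y) (E-∏ y x)))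
           (trans (sym (*-assoc _ _ _)) (trans (*-congʳ (ζ*M w y)) (*-comm _ _))))) ⟩
    ∑ (cliffs δ n) (λ y → (∏ λ j → ι (lookup (word y) j ≡ᵇ lookup (word x) j)) * M w y)
      ≈⟨ ∑-cliffs-∏-* δ n
           (λ j b → ι (b ≡ᵇ lookup (word x) j)) (λ j → μ₁ (lookup (word w) j))
           (λ j → sum-[≡]-≤ (μ₁ (lookup (word w) j)) (bounded x j)) ⟩
    M w x ∎

  H-∏ : ∀ (w x : Cliff δ n) → H w x ≈ ∏ λ j → φ (lookup (word w) j) (lookup (word x) j)
  H-∏ {n} w x = begin
    H w x
      ≈⟨ ∑-cong (cliffs δ n) (λ y → trans (when-≼ y w) (*-congˡ (F-∏ y x))) ⟩
    ∑ (cliffs δ n) (λ y → (∏ λ j → ζ (lookup (word y) j) (lookup (word w) j)) * M y x)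
      ≈⟨ ∑-cliffs-∏-* δ n
           (λ j b → ζ b (lookup (word w) j)) (λ j b → μ₁ b (lookup (word x) j))
           (λ j → sum-ζ*μ₁ (lookup (word w) j) _ (bounded x j)) ⟩
    (∏ λ j → φ (lookup (word w) j) (lookup (word x) j)) ∎

  -- Partial compositions in coordinates.

  E-comp-∏ : ∀ (u : Cliff δ m) i (v : Cliff δ n) (x : Cliff δ (m + n)) →
    E-comp u i v x ≈
    (∏ λ j → ι (lookup (word u) j ≡ᵇ lookup (word x) (hostIndex i j))) *
    (∏ λ j → ι (lookup (word v) j ≡ᵇ lookup (word x) (guestIndex i j)))
  E-comp-∏ u i v x = begin
    E-comp u i v x
      ≈⟨ word-equality ⟩
    ι (does (Vec.≡-dec ℕ._≟_ uv (word x)))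
      ≈⟨ ι-≟ uv (word x) ⟩
    (∏ λ k → ι (lookup uv k ≡ᵇ lookup (word x) k))
      ≈⟨ sum-host-guest *-commutativeMonoid i _ ⟩
    (∏ λ j → ι (lookup uv (hostIndex i j) ≡ᵇ lookup (word x) (hostIndex i j))) *
    (∏ λ j → ι (lookup uv (guestIndex i j) ≡ᵇ lookup (word x) (guestIndex i j)))
      ≈⟨ *-cong
           (∏-cong λ j → ι-cong (cong (_≡ᵇ _) (lookup-host (word u) i (word v) j)))
           (∏-cong λ j → ι-cong (cong (_≡ᵇ _) (lookup-guest (word u) i (word v) j))) ⟩
    (∏ λ j → ι (lookup (word u) j ≡ᵇ lookup (word x) (hostIndex i j))) *
    (∏ λ j → ι (lookup (word v) j ≡ᵇ lookup (word x) (guestIndex i j))) ∎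
    where
    uv = word u □[ i ] word v

    word-equality : E-comp u i v x ≈ ι (does (Vec.≡-dec ℕ._≟_ uv (word x)))
    word-equality with isCliff? δ uv
    ... | yes p = trans (when-≈ (cliff uv p ≟ x) λ _ → refl) (*-identityʳ _)
    ... | no ¬p with Vec.≡-dec ℕ._≟_ uv (word x)
    -- Since `x` is a cliff, a word that is not one differs from it: the zero composite agrees with
    -- the bracket.
    ...   | yes uv≡x = contradiction (≡.subst (IsCliff δ) (≡.sym uv≡x) (bounded x)) ¬p
    ...   | no _     = refl

  -- Treats host and guest alike: `f` places the letters of `w` in the composite word `r`, of which
  -- only the letters at these places matter.
  ∑-H-embedded : ∀ {N} (x : Cliff δ N) (r : Word N)
    (f : Fin n → Fin N) (pos : Fin n → ℕ⁺) → (∀ j → 1+ toℕ (f j) ≡ pos j) → (w : Cliff δ n) →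
    (∀ j → lookup r (f j) ≡ lookup (modify pos w) j) →
    ∑ (cliffs δ n) (λ y → H w y * (∏ λ j → ι (lookup (word y) j ≡ᵇ lookup (word x) (f j)))) ≈
    ∏ λ j → φ (lookup (word (reduce δ r)) (f j)) (lookup (word x) (f j))
  ∑-H-embedded {n} x r f pos f-pos w r-w = trans
    (∑-cong (cliffs δ n) λ y → *-congʳ (H-∏ w y))
    (∑-cliffs-∏-* δ n
      (λ j → φ (lookup (word w) j)) (λ j b → ι (b ≡ᵇ lookup (word x) (f j))) λ j →
      trans (sum-φ-[≡] (bounded w j) (bounded x (f j)))
            (reflexive (cong (λ a → φ a (lookup (word x) (f j))) (≡.sym (letter j)))))
    where
    letter : ∀ j → lookup (word (reduce δ r)) (f j) ≡
      (if does (lookup (word w) j ℕ.≟ δ (1+ toℕ j))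
       then δ (1+ toℕ (f j)) else lookup (word w) j) ⊓ δ (1+ toℕ (f j))
    -- `f-pos` matches the position read by `modify` with the one at which `reduce` truncates.
    letter j = ≡.trans (Vec.lookup∘tabulate _ (f j)) (cong (_⊓ _)
      (≡.trans (r-w j) (≡.trans (Vec.lookup∘tabulate _ j)
        (cong (λ p → if does (lookup (word w) j ℕ.≟ δ (1+ toℕ j))
                     then δ p else lookup (word w) j)
              (≡.sym (f-pos j))))))

  H-∘ : ∀ {m n} (u : Cliff δ m) (v : Cliff δ n) (i : Fin (suc m)) →
        H u ∘⟨ i ⟩ H v ≋ H (reduce δ (u ■[ i ] v))
  H-∘ {m} {n} u v i x = begin
    (H u ∘⟨ i ⟩ H v) x
      -- `E-comp` splits into a factor in `u′` and one in `v′`; `interchange` pairs each with its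
      -- `H` coordinate, so the double sum separates.
      ≈⟨ ∑-cong (cliffs δ m) (λ u′ → trans (∑-cong (cliffs δ n) λ v′ →
           trans (*-congˡ (E-comp-∏ u′ i v′ x)) (interchange _ _ _ _)) (∑-*ˡ (cliffs δ n) _ _)) ⟩
    ∑ (cliffs δ m) (λ u′ → (H u u′ * host u′) * ∑ (cliffs δ n) λ v′ → H v v′ * guest v′)
      ≈⟨ ∑-*ʳ (cliffs δ m) _ _ ⟩
    ∑ (cliffs δ m) (λ u′ → H u u′ * host u′) * ∑ (cliffs δ n) (λ v′ → H v v′ * guest v′)
      ≈⟨ *-cong
           (∑-H-embedded x r (hostIndex i) _ (hostIndex-position i n) u
             (lookup-host (modify _ u) i (modify _ v)))
           (∑-H-embedded x r (guestIndex i) _ (guestIndex-position i) v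
             (lookup-guest (modify _ u) i (modify _ v))) ⟩
    _
      ≈⟨ sum-host-guest *-commutativeMonoid i
           (λ k → φ (lookup (word (reduce δ r)) k) (lookup (word x) k)) ⟨
    (∏ λ k → φ (lookup (word (reduce δ r)) k) (lookup (word x) k))
      ≈⟨ H-∏ (reduce δ r) x ⟨
    H (reduce δ r) x ∎
    where
    r = u ■[ i ] v

    host : Cliff δ m → Carrier
    host u′ = ∏ λ j → ι (lookup (word u′) j ≡ᵇ lookup (word x) (hostIndex i j))

    guest : Cliff δ n → Carrier
    guest v′ = ∏ λ j → ι (lookup (word v′) j ≡ᵇ lookup (word x) (guestIndex i j))

proposition2p2p4 :
    ∀ {c ℓ₁ ℓ₂} (K : HeytingField c ℓ₁ ℓ₂) → CharacteristicZero K →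
    (δ : RangeMap) → Unimodal δ →
    let open Operad K δ in
    ∀ {m n : ℕ} (u : Cliff δ m) (v : Cliff δ n) (i : Fin ∣ word u ∣) →
    H u ∘⟨ i ⟩ H v ≋ H (reduce δ (u ■[ i ] v))
proposition2p2p4 K _ δ _ = H-∘ K δ
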